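{- Let $v\ge 3$, let $\mathbf s=(s_1,\dots,s_v)$ be an arbitrary vector of non-negative integers, and let $m\le \Sigma(\mathbf s)$. Then the greedy strategy is the unique optimal strategy for the $m$-round $\mathbf s$-game.
   Context: For a vector $\mathbf s=(s_1,\dots,s_v)$ of non-negative integers, the $\mathbf s$-deck consists of $s_i$ cards of Value $i$ for each $i\in\{1,\dots,v\}$; $\Sigma(\mathbf s)=s_1+\dots+s_v$. In the $m$-round $\mathbf s$-game, the deck is shuffled uniformly at random; in each of $m$ rounds the player names a value in $\{1,\dots,v\}$ and then the top card of the remaining deck is turned face up. The player loses if in at least one round the turned card has the named value, and wins otherwise. Strategies are adaptive: the bid in each round may depend on the cards turned in previous rounds. The greedy strategy is any strategy which in every round names a value that appears the least number of times among the cards remaining in the deck (any two such strategies have the same winning probability, and are collectively called the greedy strategy). A strategy is optimal if it maximizes the probability of winning. -}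

module Defs where

open import Data.Nat as ℕ using (ℕ; zero; suc; _≤_; _<_; pred)
open import Data.Fin using (Fin)
import Data.Fin as Fin
open import Data.Vec using (Vec; lookup; updateAt; sum)
open import Data.List using (List; []; _∷ʳ_; length)
open import Data.Integer using (+_)
open import Data.Rational using (ℚ; _/_; 0ℚ; 1ℚ; _+_; _*_)
import Data.Rational as ℚ
open import Relation.Binary.PropositionalEquality using (_≡_; _≢_)
open import Relation.Nullary using (yes; no)

-- A strategy: the bid depends on the (chronological) list of cards turned so far.
Strategy : ℕ → Set
Strategy v = List (Fin v) → Fin v

removeCard : ∀ {v} → Vec ℕ v → Fin v → Vec ℕ v
removeCard s j = updateAt s j pred

sumFin : ∀ {n} → (Fin n → ℚ) → ℚ
sumFin {zero}  f = 0ℚ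
sumFin {suc n} f = f Fin.zero + sumFin (λ i → f (Fin.suc i))

-- winProb σ s h m : probability of winning the remaining m rounds with strategy σ,
-- when the remaining (uniformly shuffled) deck is s and the cards turned so far are h.
-- The next card has value j with probability s_j / Σ(s).
winProb : ∀ {v} → Strategy v → Vec ℕ v → List (Fin v) → ℕ → ℚ

-- contribution of the next card having value j (total remaining cards: suc t)
roundTerm : ∀ {v} → Strategy v → Vec ℕ v → List (Fin v) → ℕ → ℕ → Fin v → ℚ
roundTerm σ s h m t j with σ h Fin.≟ j
... | yes _ = 0ℚ     -- the named value is turned: the player loses
... | no  _ = ((+ lookup s j) / suc t) * winProb σ (removeCard s j) (h ∷ʳ j) m

winProbAux : ∀ {v} → Strategy v → Vec ℕ v → List (Fin v) → ℕ → ℕ → ℚ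
winProbAux σ s h m zero    = 1ℚ   -- deck exhausted (does not occur when m ≤ Σ(s))
winProbAux σ s h m (suc t) = sumFin (roundTerm σ s h m t)

winProb σ s h zero    = 1ℚ
winProb σ s h (suc m) = winProbAux σ s h m (sum s)

winProbability : ∀ {v} → Strategy v → Vec ℕ v → ℕ → ℚ
winProbability σ s m = winProb σ s [] m

Optimal : ∀ {v} → Vec ℕ v → ℕ → Strategy v → Set
Optimal s m σ = ∀ τ → winProbability τ s m ℚ.≤ winProbability σ s m

-- Reach σ s₀ s h : the history h (with remaining deck s) arises with positive
-- probability in the s₀-game played with σ, and the player has not yet lost.
data Reach {v} (σ : Strategy v) (s₀ : Vec ℕ v) : Vec ℕ v → List (Fin v) → Set where
  start : Reach σ s₀ s₀ []
  step  : ∀ {s h} → Reach σ s₀ s h → (j : Fin v) → 0 < lookup s j → σ h ≢ j →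
          Reach σ s₀ (removeCard s j) (h ∷ʳ j)

Greedy : ∀ {v} → Vec ℕ v → ℕ → Strategy v → Set
Greedy {v} s₀ m σ = ∀ s h → Reach σ s₀ s h → length h < m →
  (j : Fin v) → lookup s (σ h) ≤ lookup s j

{-# OPTIONS --safe #-}
module Submission where

-- Multiplying winning probabilities by the number of deals turns them into counts.  Let B_m(s)
-- be the best count with m rounds and deck s, and w_m(s, i) = s_i B_m(s − e_i), so that
-- B_{m+1}(s) is the maximum over bids l of Σ_{j ≠ l} w_m(s, j).  It suffices that w_m(s, i)
-- increases strictly with s_i, for then the best bids are exactly the rarest values.
--
-- If s_i = s_k, the weights agree by symmetry.  If s_i < s_k, expand both weights by the
-- value j of the second card, using a best bid l for s − e_i on both sides.  Since
-- s_i w(s − e_i, j) = s_j w(s − e_j, i) for i ≠ j, the induction hypothesis gives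
-- s_i w(s − e_i, j) ≤ s_k w(s − e_k, j) for every j, including j = i and j = k, so
-- the sums over j ≠ l compare as well.  For v ≥ 3 some term with j ≠ l is strict.

open import Defs
open import Data.Nat using (ℕ; _≤_)
open import Data.Vec using (Vec; sum)
open import Data.Product using (_×_)
open import Data.Bool using (if_then_else_)
open import Data.Fin using (Fin; zero; suc)
open import Data.Fin.Properties using (_≟_)
open import Data.Fin.Permutation using (Permutation′; _⟨$⟩ʳ_; transpose)
import Data.Integer as ℤ
import Data.Integer.Properties as ℤₚ
open import Data.List using (List; []; _∷ʳ_; allFin; foldl; length)
open import Data.List.Extrema.Nat using (argmax; argmin; f[xs]≤f[argmax]; f[argmin]≤f[xs])
open import Data.List.Membership.Propositional.Properties using (∈-allFin)
open import Data.List.Properties using (foldl-∷ʳ; length-++)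
import Data.List.Relation.Unary.All as All
open import Data.Nat using (zero; suc; _+_; _*_; _<_; pred; z≤n; s≤s; >-nonZero)
open import Data.Nat.Coprimality using (1-coprimeTo) renaming (sym to coprime-sym)
open import Data.Nat.Properties hiding (_≟_)
open import Data.Product using (_,_; ∃)
open import Data.Rational using (ℚ; mkℚ; Positive)
import Data.Rational as ℚ
import Data.Rational.Properties as ℚₚ
import Data.Rational.Unnormalised as ℚᵘ
import Data.Rational.Unnormalised.Properties as ℚᵘₚ
open import Data.Sum using (_⊎_; inj₁; inj₂)
open import Data.Vec using (lookup; _∷_)
open import Data.Vec.Properties using (lookup∘updateAt; lookup∘updateAt′; updateAt-commutes)
open import Function using (_∘_)
open import Function.Bundles using (module Injection)
open import Function.Properties.Inverse using (↔⇒↣)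
open import Relation.Binary.PropositionalEquality using (_≡_; _≢_; refl; sym; trans; cong; cong₂; subst; module ≡-Reasoning)
open import Relation.Nullary using (does; yes; no; contradiction)
open import Relation.Nullary.Decidable using (dec-true; dec-false)
open import Algebra.Properties.Semiring.Sum +-*-semiring using (sum-permute; sum-cong-≗; *-distribˡ-sum) renaming (sum to ∑)
open import Algebra.Properties.CommutativeSemigroup *-commutativeSemigroup using (x∙yz≈y∙xz)

private variable
  n v : ℕ

-- Sums of natural numbers that omit one index.

∑-mono-≤ : {f g : Fin n → ℕ} → (∀ j → f j ≤ g j) → ∑ f ≤ ∑ g
∑-mono-≤ {zero}  f≤g = z≤n
∑-mono-≤ {suc n} f≤g = +-mono-≤ (f≤g zero) (∑-mono-≤ (f≤g ∘ suc))

∑-mono-< : {f g : Fin n → ℕ} → (∀ j → f j ≤ g j) → ∀ k → f k < g k → ∑ f < ∑ g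
∑-mono-< f≤g zero    fk<gk = +-mono-<-≤ fk<gk (∑-mono-≤ (f≤g ∘ suc))
∑-mono-< f≤g (suc k) fk<gk = +-mono-≤-< (f≤g zero) (∑-mono-< (f≤g ∘ suc) k fk<gk)

mask : Fin n → (Fin n → ℕ) → Fin n → ℕ
mask l f j = if does (l ≟ j) then 0 else f j

∑≢ : Fin n → (Fin n → ℕ) → ℕ
∑≢ l f = ∑ (mask l f)

∑≢-split : ∀ l (f : Fin n → ℕ) → f l + ∑≢ l f ≡ ∑ f
∑≢-split zero    f = refl
∑≢-split (suc l) f = begin
  f (suc l) + (f zero + ∑≢ l (f ∘ suc)) ≡⟨ +-assoc (f (suc l)) (f zero) _ ⟨
  f (suc l) + f zero + ∑≢ l (f ∘ suc)   ≡⟨ cong (_+ ∑≢ l (f ∘ suc)) (+-comm (f (suc l)) (f zero)) ⟩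
  f zero + f (suc l) + ∑≢ l (f ∘ suc)   ≡⟨ +-assoc (f zero) (f (suc l)) _ ⟩
  f zero + (f (suc l) + ∑≢ l (f ∘ suc)) ≡⟨ cong (f zero +_) (∑≢-split l (f ∘ suc)) ⟩
  f zero + ∑ (f ∘ suc)                  ∎
  where open ≡-Reasoning

-- Restoring the omitted term gives the same total `∑ f` on both sides, so omitting less leaves
-- more. For weights this says that a bid is better the less its value weighs.
∑≢-anti-≤ : ∀ {i l} (f : Fin n → ℕ) → f i ≤ f l → ∑≢ l f ≤ ∑≢ i f
∑≢-anti-≤ {i = i} {l} f fi≤fl = +-cancelˡ-≤ (f i) _ _ (begin
  f i + ∑≢ l f ≤⟨ +-monoˡ-≤ _ fi≤fl ⟩
  f l + ∑≢ l f ≡⟨ trans (∑≢-split l f) (sym (∑≢-split i f)) ⟩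
  f i + ∑≢ i f ∎)
  where open ≤-Reasoning

∑≢-anti-< : ∀ {i l} (f : Fin n → ℕ) → f i < f l → ∑≢ l f < ∑≢ i f
∑≢-anti-< {i = i} {l} f fi<fl = +-cancelˡ-< (f i) _ _ (begin-strict
  f i + ∑≢ l f <⟨ +-monoˡ-< _ fi<fl ⟩
  f l + ∑≢ l f ≡⟨ trans (∑≢-split l f) (sym (∑≢-split i f)) ⟩
  f i + ∑≢ i f ∎)
  where open ≤-Reasoning

mask-mono-≤ : ∀ l {f g : Fin n → ℕ} → (∀ j → l ≢ j → f j ≤ g j) → ∀ j → mask l f j ≤ mask l g j
mask-mono-≤ l f≤g j with l ≟ j
... | yes _  = z≤n
... | no l≢j = f≤g j l≢j

∑≢-mono-≤ : ∀ l {f g : Fin n → ℕ} → (∀ j → l ≢ j → f j ≤ g j) → ∑≢ l f ≤ ∑≢ l g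
∑≢-mono-≤ l f≤g = ∑-mono-≤ (mask-mono-≤ l f≤g)

∑≢-mono-< : ∀ l {f g : Fin n → ℕ} → (∀ j → l ≢ j → f j ≤ g j) →
            ∀ k → l ≢ k → f k < g k → ∑≢ l f < ∑≢ l g
∑≢-mono-< l {f} {g} f≤g k l≢k fk<gk = ∑-mono-< (mask-mono-≤ l f≤g) k masked
  where
  masked : mask l f k < mask l g k
  masked rewrite dec-false (l ≟ k) l≢k = fk<gk

*-distribˡ-∑≢ : ∀ c l (f : Fin n → ℕ) → c * ∑≢ l f ≡ ∑≢ l (λ j → c * f j)
*-distribˡ-∑≢ c l f = trans (*-distribˡ-sum c (mask l f)) (sum-cong-≗ masked)
  where
  masked : ∀ j → c * mask l f j ≡ mask l (λ j → c * f j) j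
  masked j with l ≟ j
  ... | yes _ = *-zeroʳ c
  ... | no _  = refl

∑≢-permute : ∀ (π : Permutation′ n) l (f : Fin n → ℕ) → ∑≢ (π ⟨$⟩ʳ l) f ≡ ∑≢ l (f ∘ (π ⟨$⟩ʳ_))
∑≢-permute π l f = trans (sum-permute (mask (π ⟨$⟩ʳ l) f) π) (sum-cong-≗ masked)
  where
  masked : ∀ j → mask (π ⟨$⟩ʳ l) f (π ⟨$⟩ʳ j) ≡ mask l (f ∘ (π ⟨$⟩ʳ_)) j
  masked j with l ≟ j
  ... | yes l≡j rewrite dec-true ((π ⟨$⟩ʳ l) ≟ (π ⟨$⟩ʳ j)) (cong (π ⟨$⟩ʳ_) l≡j) = refl
  ... | no  l≢j rewrite dec-false ((π ⟨$⟩ʳ l) ≟ (π ⟨$⟩ʳ j))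
                          (l≢j ∘ Injection.injective (↔⇒↣ π)) = refl

-- Cards and their removal from a deck.

n≡0∨n>0 : ∀ n → n ≡ 0 ⊎ 0 < n
n≡0∨n>0 zero    = inj₁ refl
n≡0∨n>0 (suc _) = inj₂ (s≤s z≤n)

avoid : (i k : Fin (3 + n)) → ∃ λ j → j ≢ i × j ≢ k
avoid zero          zero          = suc zero , (λ ()) , (λ ())
avoid zero          (suc zero)    = suc (suc zero) , (λ ()) , (λ ())
avoid zero          (suc (suc _)) = suc zero , (λ ()) , (λ ())
avoid (suc zero)    zero          = suc (suc zero) , (λ ()) , (λ ())
avoid (suc (suc _)) zero          = suc zero , (λ ()) , (λ ())
avoid (suc _)       (suc _)       = zero , (λ ()) , (λ ())

sum-removeCard : ∀ (s : Vec ℕ v) j → 0 < lookup s j → suc (sum (removeCard s j)) ≡ sum s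
sum-removeCard (suc x ∷ s) zero    _    = refl
sum-removeCard (x ∷ s)     (suc j) 0<sj =
  trans (sym (+-suc x _)) (cong (x +_) (sum-removeCard s j 0<sj))

sum-positive : ∀ (s : Vec ℕ v) → 0 < sum s → ∃ λ j → 0 < lookup s j
sum-positive (suc x ∷ s) _ = zero , s≤s z≤n
sum-positive (zero ∷ s)  p with sum-positive s p
... | j , 0<sj = suc j , 0<sj

≤-sum-removeCard : ∀ {m} (s : Vec ℕ v) j → 0 < lookup s j → suc m ≤ sum s → m ≤ sum (removeCard s j)
≤-sum-removeCard s j 0<sj m<Σ = ≤-pred (≤-trans m<Σ (≤-reflexive (sym (sum-removeCard s j 0<sj))))

lookup-removeCard : ∀ (s : Vec ℕ v) j → lookup (removeCard s j) j ≡ pred (lookup s j)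
lookup-removeCard s j = lookup∘updateAt j s

lookup-removeCard-≢ : ∀ (s : Vec ℕ v) {i j} → i ≢ j → lookup (removeCard s j) i ≡ lookup s i
lookup-removeCard-≢ s {i} {j} i≢j = lookup∘updateAt′ i j i≢j s

removeCard-comm : ∀ (s : Vec ℕ v) i j → removeCard (removeCard s i) j ≡ removeCard (removeCard s j) i
removeCard-comm s i j with j ≟ i
... | yes refl = refl
... | no j≢i   = updateAt-commutes j i j≢i s

-- Best counts and their symmetry under renaming of values.

abstract
  maximiser : (Fin (suc n) → ℕ) → Fin (suc n)
  maximiser f = argmax f zero (allFin _)

  ≤-maximiser : ∀ (f : Fin (suc n) → ℕ) j → f j ≤ f (maximiser f)
  ≤-maximiser f j = All.lookup (f[xs]≤f[argmax] {f = f} zero (allFin _)) (∈-allFin j)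

-- best m s is the largest number of winning deals of m cards, over all strategies.
best : ℕ → Vec ℕ (suc n) → ℕ
-- If no card has value `j`, `removeCard` leaves the deck as it is, but the factor `lookup s j`
-- annihilates the term.
weight : ℕ → Vec ℕ (suc n) → Fin (suc n) → ℕ
bestBid : ℕ → Vec ℕ (suc n) → Fin (suc n)

best zero    s = 1
best (suc m) s = ∑≢ (bestBid m s) (weight m s)

weight m s j = lookup s j * best m (removeCard s j)

bestBid m s = maximiser (λ l → ∑≢ l (weight m s))

bid≤best : ∀ m (s : Vec ℕ (suc n)) l → ∑≢ l (weight m s) ≤ best (suc m) s
bid≤best m s = ≤-maximiser (λ l → ∑≢ l (weight m s))

-- A bid `l` for `s` is imitated by the bid `π l` for `t`, and the decks that remain are again
-- related by `π`.
best-permute : ∀ m (π : Permutation′ (suc n)) (s t : Vec ℕ (suc n)) →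
               (∀ j → lookup s j ≡ lookup t (π ⟨$⟩ʳ j)) → best m s ≤ best m t
best-permute zero    π s t s≡tπ = ≤-refl
best-permute (suc m) π s t s≡tπ = begin
  ∑≢ l (weight m s)                ≤⟨ ∑≢-mono-≤ l (λ j _ → weight-≤ j) ⟩
  ∑≢ l (weight m t ∘ (π ⟨$⟩ʳ_))    ≡⟨ ∑≢-permute π l (weight m t) ⟨
  ∑≢ (π ⟨$⟩ʳ l) (weight m t)       ≤⟨ bid≤best m t (π ⟨$⟩ʳ l) ⟩
  best (suc m) t                   ∎
  where
  open ≤-Reasoning
  l = bestBid m s
  removed : ∀ j i → lookup (removeCard s j) i ≡ lookup (removeCard t (π ⟨$⟩ʳ j)) (π ⟨$⟩ʳ i)
  removed j i with i ≟ j
  ... | yes refl = trans (lookup-removeCard s i) (trans (cong pred (s≡tπ i)) (sym (lookup-removeCard t _)))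
  ... | no i≢j   = trans (lookup-removeCard-≢ s i≢j) (trans (s≡tπ i) (sym (lookup-removeCard-≢ t (i≢j ∘ Injection.injective (↔⇒↣ π)))))
  weight-≤ : ∀ j → weight m s j ≤ weight m t (π ⟨$⟩ʳ j)
  weight-≤ j = *-mono-≤ (≤-reflexive (s≡tπ j)) (best-permute m π _ _ (removed j))

-- When the two counts agree, exchanging the names `i` and `k` carries the deck without one `i` to
-- the deck without one `k`.
weight-tie : ∀ m (s : Vec ℕ (suc n)) i k → lookup s i ≡ lookup s k → weight m s i ≤ weight m s k
weight-tie m s i k si≡sk =
  *-mono-≤ (≤-reflexive si≡sk) (best-permute m (transpose i k) _ _ swapped)
  where
  swapped : ∀ j → lookup (removeCard s i) j ≡ lookup (removeCard s k) (transpose i k ⟨$⟩ʳ j)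
  -- The tests are made in the order used by `transpose`, so its value reduces in every case.
  swapped j with j ≟ i
  ... | yes refl = trans (lookup-removeCard s j) (trans (cong pred si≡sk) (sym (lookup-removeCard s k)))
  ... | no j≢i with j ≟ k
  ...   | yes refl = trans (lookup-removeCard-≢ s j≢i)
                       (trans (sym si≡sk) (sym (lookup-removeCard-≢ s (j≢i ∘ sym))))
  ...   | no j≢k   = trans (lookup-removeCard-≢ s j≢i) (sym (lookup-removeCard-≢ s j≢k))

-- Both sides equal s_i s_j B_m(s − e_i − e_j).
weight-exchange : ∀ m (s : Vec ℕ (suc n)) {i j} → i ≢ j →
  lookup s i * weight m (removeCard s i) j ≡ lookup s j * weight m (removeCard s j) i
weight-exchange m s {i} {j} i≢j = begin
  a * (lookup (removeCard s i) j * best m (removeCard (removeCard s i) j))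
    ≡⟨ cong₂ (λ x t → a * (x * best m t)) (lookup-removeCard-≢ s (i≢j ∘ sym)) (removeCard-comm s i j) ⟩
  a * (b * c)
    ≡⟨ x∙yz≈y∙xz a b c ⟩
  b * (a * c)
    ≡⟨ cong (λ x → b * (x * c)) (lookup-removeCard-≢ s i≢j) ⟨
  b * (lookup (removeCard s j) i * c) ∎
  where
  open ≡-Reasoning
  a = lookup s i
  b = lookup s j
  c = best m (removeCard (removeCard s j) i)

-- Weights increase with the number of cards.

lookup-<⇒≢ : ∀ (s : Vec ℕ v) {i k} → lookup s i < lookup s k → i ≢ k
lookup-<⇒≢ s si<sk refl = <-irrefl refl si<sk

removed-< : ∀ (s : Vec ℕ v) {i k} → lookup s i < lookup s k →
            0 < lookup s i → lookup (removeCard s i) i < lookup (removeCard s i) k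
removed-< s {i} {k} si<sk 0<si rewrite lookup-removeCard s i
  | lookup-removeCard-≢ s (lookup-<⇒≢ s si<sk ∘ sym) = ≤-<-trans pred[n]≤n si<sk

-- The comparison holds for every second card j separately, so also after any second bid.
second-≤ : ∀ m → (∀ (s : Vec ℕ (suc n)) i k → lookup s i ≤ lookup s k → weight m s i ≤ weight m s k) →
  ∀ s i k → lookup s i < lookup s k → ∀ j →
  lookup s i * weight m (removeCard s i) j ≤ lookup s k * weight m (removeCard s k) j
second-≤ m IH s i k si<sk j with j ≟ i | j ≟ k
... | yes refl | _ = ≤-trans (*-monoʳ-≤ (lookup s i) (IH (removeCard s i) i k rest))
                       (≤-reflexive (weight-exchange m s (lookup-<⇒≢ s si<sk)))
  where
  rest : lookup (removeCard s i) i ≤ lookup (removeCard s i) k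
  rest rewrite lookup-removeCard s i | lookup-removeCard-≢ s (lookup-<⇒≢ s si<sk ∘ sym) =
    ≤-trans pred[n]≤n (<⇒≤ si<sk)
... | no _ | yes refl = ≤-trans (≤-reflexive (weight-exchange m s (lookup-<⇒≢ s si<sk)))
                          (*-monoʳ-≤ (lookup s k) (IH (removeCard s k) i k rest))
  where
  rest : lookup (removeCard s k) i ≤ lookup (removeCard s k) k
  -- Strictness of `si<sk` is used here: one card of value `k` can be spared.
  rest rewrite lookup-removeCard s k | lookup-removeCard-≢ s (lookup-<⇒≢ s si<sk) = <⇒≤pred si<sk
... | no j≢i | no j≢k = begin
  lookup s i * weight m (removeCard s i) j ≡⟨ weight-exchange m s (j≢i ∘ sym) ⟩
  lookup s j * weight m (removeCard s j) i ≤⟨ *-monoʳ-≤ (lookup s j) (IH (removeCard s j) i k rest) ⟩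
  lookup s j * weight m (removeCard s j) k ≡⟨ weight-exchange m s j≢k ⟩
  lookup s k * weight m (removeCard s k) j ∎
  where
  open ≤-Reasoning
  rest : lookup (removeCard s j) i ≤ lookup (removeCard s j) k
  rest rewrite lookup-removeCard-≢ s (j≢i ∘ sym) | lookup-removeCard-≢ s (j≢k ∘ sym) = <⇒≤ si<sk

-- A tie goes to symmetry, since removing a card of value `k` would reverse the order of the counts.
-- Otherwise `l` is a best bid on the left and merely a possible bid on the right.
weight-mono-≤ : ∀ m (s : Vec ℕ (suc n)) i k → lookup s i ≤ lookup s k → weight m s i ≤ weight m s k
weight-mono-≤ zero    s i k si≤sk = *-monoˡ-≤ 1 si≤sk
weight-mono-≤ (suc m) s i k si≤sk with m≤n⇒m<n∨m≡n si≤sk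
... | inj₂ si≡sk = weight-tie (suc m) s i k si≡sk
... | inj₁ si<sk = begin
  a * ∑≢ l (weight m (removeCard s i))           ≡⟨ *-distribˡ-∑≢ a l (weight m (removeCard s i)) ⟩
  ∑≢ l (λ j → a * weight m (removeCard s i) j)   ≤⟨ ∑≢-mono-≤ l (λ j _ → second-≤ m (weight-mono-≤ m) s i k si<sk j) ⟩
  ∑≢ l (λ j → b * weight m (removeCard s k) j)   ≡⟨ *-distribˡ-∑≢ b l (weight m (removeCard s k)) ⟨
  b * ∑≢ l (weight m (removeCard s k))           ≤⟨ *-monoʳ-≤ b (bid≤best m (removeCard s k) l) ⟩
  b * best (suc m) (removeCard s k)              ∎
  where
  open ≤-Reasoning
  a = lookup s i
  b = lookup s k
  l = bestBid m (removeCard s i)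

-- Bidding anything but a value `k` still in the deck lets a deal that starts with `k` survive, and
-- the rest follows by induction.
best-positive : ∀ m (s : Vec ℕ (3 + n)) → m ≤ sum s → 0 < best m s
best-positive zero    s _   = s≤s z≤n
best-positive (suc m) s m<Σ with sum-positive s (≤-trans (s≤s z≤n) m<Σ)
... | k , 0<sk with avoid k k
...   | l , l≢k , _ = ≤-trans (≤-<-trans z≤n (∑≢-mono-< l {f = λ _ → 0} {weight m s} (λ _ _ → z≤n) k l≢k
          (*-mono-< 0<sk (best-positive m (removeCard s k) (≤-sum-removeCard s k 0<sk m<Σ))))) (bid≤best m s l)

weight-mono-< : ∀ m (s : Vec ℕ (3 + n)) i k → m < sum s →
                lookup s i < lookup s k → weight m s i < weight m s k
weight-mono-< zero    s i k _   si<sk = *-monoˡ-< 1 si<sk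
weight-mono-< {n} (suc m) s i k m<Σ si<sk with n≡0∨n>0 (lookup s i)
-- The left weight vanishes, so positivity of the right one is enough.
... | inj₁ si≡0 rewrite si≡0 = *-mono-< si<sk (best-positive (suc m) (removeCard s k) (≤-sum-removeCard s k si<sk m<Σ))
... | inj₂ 0<si = result
  where
  open ≤-Reasoning
  a = lookup s i
  b = lookup s k
  0<b : 0 < b
  0<b = <-trans 0<si si<sk

  -- Here `l` is any bid that attains the maximum, not necessarily `bestBid`, so that an absent
  -- value may take its place.
  via : ∀ l j → best (suc m) (removeCard s i) ≤ ∑≢ l (weight m (removeCard s i)) → l ≢ j →
        a * weight m (removeCard s i) j < b * weight m (removeCard s k) j →
        weight (suc m) s i < weight (suc m) s k
  via l j best≤ l≢j aw<bw = begin-strict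
    a * best (suc m) (removeCard s i)              ≤⟨ *-monoʳ-≤ a best≤ ⟩
    a * ∑≢ l (weight m (removeCard s i))           ≡⟨ *-distribˡ-∑≢ a l (weight m (removeCard s i)) ⟩
    ∑≢ l (λ j → a * weight m (removeCard s i) j)   <⟨ ∑≢-mono-< l (λ j _ → second-≤ m (weight-mono-≤ m) s i k si<sk j) j l≢j aw<bw ⟩
    ∑≢ l (λ j → b * weight m (removeCard s k) j)   ≡⟨ *-distribˡ-∑≢ b l (weight m (removeCard s k)) ⟨
    b * ∑≢ l (weight m (removeCard s k))           ≤⟨ *-monoʳ-≤ b (bid≤best m (removeCard s k) l) ⟩
    b * best (suc m) (removeCard s k)              ∎

  -- Removing a card of value `i` keeps the counts of `i` and `k` apart, whereas removing one of
  -- value `k` could make them equal.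
  strict-at-i : a * weight m (removeCard s i) i < b * weight m (removeCard s k) i
  strict-at-i = begin-strict
    a * weight m (removeCard s i) i <⟨ *-monoʳ-< a {{>-nonZero 0<si}} (weight-mono-< m (removeCard s i) i k
                                        (≤-sum-removeCard s i 0<si m<Σ) (removed-< s si<sk 0<si)) ⟩
    a * weight m (removeCard s i) k ≡⟨ weight-exchange m s (lookup-<⇒≢ s si<sk) ⟩
    b * weight m (removeCard s k) i ∎

  strict-at : ∀ j → j ≢ i → j ≢ k → 0 < lookup s j →
              a * weight m (removeCard s i) j < b * weight m (removeCard s k) j
  strict-at j j≢i j≢k 0<sj = begin-strict
    a * weight m (removeCard s i) j          ≡⟨ weight-exchange m s (j≢i ∘ sym) ⟩
    lookup s j * weight m (removeCard s j) i <⟨ *-monoʳ-< (lookup s j) {{>-nonZero 0<sj}}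
                                                 (weight-mono-< m (removeCard s j) i k (≤-sum-removeCard s j 0<sj m<Σ) rest) ⟩
    lookup s j * weight m (removeCard s j) k ≡⟨ weight-exchange m s j≢k ⟩
    b * weight m (removeCard s k) j          ∎
    where
    rest : lookup (removeCard s j) i < lookup (removeCard s j) k
    rest rewrite lookup-removeCard-≢ s (j≢i ∘ sym) | lookup-removeCard-≢ s (j≢k ∘ sym) = si<sk

  -- With a third value j: bidding j is optimal if no card has value j;
  -- otherwise the terms at i and at j are both strict, and a bid discards only one of them.
  result : weight (suc m) s i < weight (suc m) s k
  result with avoid i k
  ... | j , j≢i , j≢k with n≡0∨n>0 (lookup s j)
  ...   | inj₁ sj≡0 = via j i (∑≢-anti-≤ {i = j} {bestBid m (removeCard s i)} (weight m (removeCard s i))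
                        (≤-trans (≤-reflexive absent) z≤n)) j≢i strict-at-i
    where
    absent : weight m (removeCard s i) j ≡ 0
    absent rewrite lookup-removeCard-≢ s j≢i | sj≡0 = refl
  ...   | inj₂ 0<sj with bestBid m (removeCard s i) ≟ i
  ...     | yes l≡i = via (bestBid m (removeCard s i)) j ≤-refl
                        (λ l≡j → j≢i (trans (sym l≡j) l≡i)) (strict-at j j≢i j≢k 0<sj)
  ...     | no  l≢i = via (bestBid m (removeCard s i)) i ≤-refl l≢i strict-at-i

-- Winning deals of a strategy, compared with the best counts.

count : Strategy v → Vec ℕ v → List (Fin v) → ℕ → ℕ
count σ s h zero    = 1
-- Deals are ordered and cards of equal value are distinct, whence the factor `lookup s j`.
count σ s h (suc m) = ∑≢ (σ h) (λ j → lookup s j * count σ (removeCard s j) (h ∷ʳ j) m)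

count≤best : ∀ (σ : Strategy (suc n)) s h m → count σ s h m ≤ best m s
count≤best σ s h zero    = ≤-refl
count≤best σ s h (suc m) = ≤-trans
  (∑≢-mono-≤ (σ h) (λ j _ → *-monoʳ-≤ (lookup s j) (count≤best σ (removeCard s j) (h ∷ʳ j) m)))
  (bid≤best m s (σ h))

length-∷ʳ : ∀ (h : List (Fin v)) j → length (h ∷ʳ j) ≡ suc (length h)
length-∷ʳ h j = trans (length-++ h) (+-comm (length h) 1)

-- A rarest value has the least weight, so bidding it loses nothing against `bestBid`. The bound on
-- `length h + m` keeps the greedy condition available in every remaining round.
greedy-count : ∀ {s₀ : Vec ℕ (suc n)} {m₀ σ} → Greedy s₀ m₀ σ → ∀ m {s h} → Reach σ s₀ s h →
               length h + m ≤ m₀ → best m s ≤ count σ s h m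
greedy-count G zero    r _ = ≤-refl
greedy-count {m₀ = m₀} {σ} G (suc m) {s} {h} r h+m≤ = begin
  ∑≢ l (weight m s)     ≤⟨ ∑≢-anti-≤ {i = σ h} {l} (weight m s)
                             (weight-mono-≤ m s (σ h) l (G s h r (≤-trans (s≤s (m≤m+n (length h) m)) h+m≤′) l)) ⟩
  ∑≢ (σ h) (weight m s) ≤⟨ ∑≢-mono-≤ (σ h) continue ⟩
  count σ s h (suc m)   ∎
  where
  open ≤-Reasoning
  l = bestBid m s
  h+m≤′ : suc (length h + m) ≤ m₀
  h+m≤′ = subst (_≤ m₀) (+-suc (length h) m) h+m≤
  continue : ∀ j → σ h ≢ j → weight m s j ≤ lookup s j * count σ (removeCard s j) (h ∷ʳ j) m
  continue j σh≢j with n≡0∨n>0 (lookup s j)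
  -- `Reach` does not extend to an absent value, but its weight is zero.
  ... | inj₁ sj≡0 rewrite sj≡0 = z≤n
  ... | inj₂ 0<sj = *-monoʳ-≤ (lookup s j) (greedy-count G m (step r j 0<sj σh≢j)
                      (subst (λ x → x + m ≤ m₀) (sym (length-∷ʳ h j)) h+m≤′))

-- Witness that an actual strategy attains `best`. The remaining deck is recomputed from the
-- history.
greedyStrategy : Vec ℕ (suc n) → Strategy (suc n)
greedyStrategy s₀ h = argmin (lookup (foldl removeCard s₀ h)) zero (allFin _)

reach-deck : ∀ {σ : Strategy v} {s₀ s h} → Reach σ s₀ s h → foldl removeCard s₀ h ≡ s
reach-deck start = refl
reach-deck {s₀ = s₀} (step {h = h} r j _ _) =
  trans (foldl-∷ʳ removeCard s₀ j h) (cong (λ t → removeCard t j) (reach-deck r))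

greedyStrategy-greedy : ∀ (s₀ : Vec ℕ (suc n)) m → Greedy s₀ m (greedyStrategy s₀)
greedyStrategy-greedy s₀ m s h r _ j rewrite reach-deck r =
  All.lookup (f[argmin]≤f[xs] {f = lookup s} zero (allFin _)) (∈-allFin j)

-- Optimality passes to every reachable history: a shortfall after `j` enters the total with the
-- positive factor `lookup s j` and would push it below `best`. The witness `m` is the number of
-- rounds left.
optimal-reach : ∀ {σ : Strategy (suc n)} {s₀ m₀} → m₀ ≤ sum s₀ → best m₀ s₀ ≤ count σ s₀ [] m₀ →
  ∀ {s h} → Reach σ s₀ s h → length h ≤ m₀ →
  ∃ λ m → length h + m ≡ m₀ × m ≤ sum s × best m s ≤ count σ s h m
optimal-reach {m₀ = m₀} m₀≤Σ opt start _ = m₀ , refl , m₀≤Σ , opt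
optimal-reach {σ = σ} m₀≤Σ opt (step {s} {h} r j 0<sj σh≢j) h≤
  rewrite length-∷ʳ h j with optimal-reach m₀≤Σ opt r (<⇒≤ h≤)
... | zero  , eq , _   , _ = contradiction (trans (sym (+-identityʳ _)) eq) (<⇒≢ h≤)
... | suc m , eq , m<Σ , best≤ =
  m , trans (sym (+-suc (length h) m)) eq , ≤-sum-removeCard s j 0<sj m<Σ , ≮⇒≥ λ count<best →
    <⇒≱ (<-≤-trans (∑≢-mono-< (σ h)
           (λ i _ → *-monoʳ-≤ (lookup s i) (count≤best σ (removeCard s i) (h ∷ʳ i) m))
           j σh≢j (*-monoʳ-< (lookup s j) {{>-nonZero 0<sj}} count<best))
         (bid≤best m s (σ h))) best≤

-- If some `j` were rarer than the bid `σ h`, its weight would be strictly smaller, and bidding `j`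
-- would win strictly more deals.
optimal-greedy : ∀ {σ : Strategy (3 + n)} {s₀ m₀} → m₀ ≤ sum s₀ → best m₀ s₀ ≤ count σ s₀ [] m₀ →
                 Greedy s₀ m₀ σ
optimal-greedy {σ = σ} m₀≤Σ opt s h r h< j with optimal-reach m₀≤Σ opt r (<⇒≤ h<)
... | zero  , eq , _   , _ = contradiction (trans (sym (+-identityʳ _)) eq) (<⇒≢ h<)
... | suc m , eq , m<Σ , best≤ = ≮⇒≥ λ sj<sσh → <⇒≱
  (<-≤-trans (∑≢-anti-< {i = j} {σ h} (weight m s) (weight-mono-< m s j (σ h) m<Σ sj<sσh)) (bid≤best m s j))
  (≤-trans best≤ (∑≢-mono-≤ (σ h) (λ i _ → *-monoʳ-≤ (lookup s i) (count≤best σ (removeCard s i) (h ∷ʳ i) m))))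

-- From counts to rational probabilities.

fromℕ : ℕ → ℚ
-- Written with `mkℚ` so that numerator and denominator compute without normalisation.
fromℕ n = mkℚ (ℤ.+ n) 0 (coprime-sym (1-coprimeTo n))

fromℕ-+ : ∀ m n → fromℕ m ℚ.+ fromℕ n ≡ fromℕ (m + n)
fromℕ-+ m n = ℚₚ.toℚᵘ-injective (ℚᵘₚ.≃-trans (ℚₚ.toℚᵘ-homo-+ (fromℕ m) (fromℕ n))
  (ℚᵘ.*≡* (cong (ℤ._* ℤ.+ 1) (cong₂ ℤ._+_ (ℤₚ.*-identityʳ (ℤ.+ m)) (ℤₚ.*-identityʳ (ℤ.+ n))))))

fromℕ-* : ∀ m n → fromℕ m ℚ.* fromℕ n ≡ fromℕ (m * n)
fromℕ-* m n = ℚₚ.toℚᵘ-injective (ℚᵘₚ.≃-trans (ℚₚ.toℚᵘ-homo-* (fromℕ m) (fromℕ n))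
  (ℚᵘ.*≡* (cong (ℤ._* ℤ.+ 1) (sym (ℤₚ.pos-* m n)))))

/-*-cancel : ∀ a t → (ℤ.+ a ℚ./ suc t) ℚ.* fromℕ (suc t) ≡ fromℕ a
/-*-cancel a t = ℚₚ.toℚᵘ-injective (ℚᵘₚ.≃-trans (ℚₚ.toℚᵘ-homo-* (ℤ.+ a ℚ./ suc t) (fromℕ (suc t)))
  (ℚᵘₚ.≃-trans (ℚᵘₚ.*-congʳ (ℚₚ.toℚᵘ-fromℚᵘ (ℚᵘ.mkℚᵘ (ℤ.+ a) t)))
  (ℚᵘ.*≡* (trans (ℤₚ.*-identityʳ _) (cong (λ d → ℤ.+ a ℤ.* ℤ.+ d) (sym (*-identityʳ (suc t))))))))

fromℕ-mono-≤ : ∀ {m n} → m ≤ n → fromℕ m ℚ.≤ fromℕ n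
fromℕ-mono-≤ m≤n = ℚ.*≤* (ℤₚ.*-monoʳ-≤-nonNeg (ℤ.+ 1) (ℤ.+≤+ m≤n))

fromℕ-cancel-≤ : ∀ {m n} → fromℕ m ℚ.≤ fromℕ n → m ≤ n
fromℕ-cancel-≤ (ℚ.*≤* m≤n) = ℤₚ.drop‿+≤+ (ℤₚ.*-cancelʳ-≤-pos _ _ (ℤ.+ 1) m≤n)

sumFin-*-fromℕ : ∀ (f : Fin n → ℚ) c (g : Fin n → ℕ) → (∀ j → f j ℚ.* c ≡ fromℕ (g j)) →
                 sumFin f ℚ.* c ≡ fromℕ (∑ g)
sumFin-*-fromℕ {zero}  f c g eq = ℚₚ.*-zeroˡ c
sumFin-*-fromℕ {suc n} f c g eq = begin
  (f zero ℚ.+ sumFin (f ∘ suc)) ℚ.* c             ≡⟨ ℚₚ.*-distribʳ-+ c (f zero) _ ⟩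
  f zero ℚ.* c ℚ.+ sumFin (f ∘ suc) ℚ.* c         ≡⟨ cong₂ ℚ._+_ (eq zero) (sumFin-*-fromℕ (f ∘ suc) c (g ∘ suc) (eq ∘ suc)) ⟩
  fromℕ (g zero) ℚ.+ fromℕ (∑ (g ∘ suc))          ≡⟨ fromℕ-+ (g zero) _ ⟩
  fromℕ (∑ g)                                     ∎
  where open ≡-Reasoning

-- The falling factorial of `t` with `m` factors: the number of ordered deals of `m` out of `t`
-- cards.
deals : ℕ → ℕ → ℕ
deals t zero    = 1
deals t (suc m) = t * deals (pred t) m

deals-positive : ∀ t m → m ≤ t → 0 < deals t m
deals-positive t       zero    _         = s≤s z≤n
deals-positive (suc t) (suc m) (s≤s m≤t) = *-mono-< {0} {suc t} (s≤s z≤n) (deals-positive t m m≤t)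

-- Each round contributes a denominator `suc t`, which cancels the leading factor of `deals`.
winProb-count : ∀ (σ : Strategy v) s h m → m ≤ sum s →
                winProb σ s h m ℚ.* fromℕ (deals (sum s) m) ≡ fromℕ (count σ s h m)
winProb-count σ s h zero    _ = refl
winProb-count σ s h (suc m) m<Σ with sum s in Σ≡
winProb-count σ s h (suc m) (s≤s m≤t) | suc t = sumFin-*-fromℕ _ _ _ term
  where
  open ≡-Reasoning
  D = deals t m
  term : ∀ j → roundTerm σ s h m t j ℚ.* fromℕ (suc t * D) ≡
               fromℕ (mask (σ h) (λ j → lookup s j * count σ (removeCard s j) (h ∷ʳ j) m) j)
  term j with σ h ≟ j
  ... | yes _ = ℚₚ.*-zeroˡ (fromℕ (suc t * D))
  ... | no _  = begin
    (p ℚ.* W) ℚ.* fromℕ (suc t * D)               ≡⟨ cong ((p ℚ.* W) ℚ.*_) (fromℕ-* (suc t) D) ⟨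
    (p ℚ.* W) ℚ.* (fromℕ (suc t) ℚ.* fromℕ D)     ≡⟨ ℚₚ.*-assoc p W (fromℕ (suc t) ℚ.* fromℕ D) ⟩
    p ℚ.* (W ℚ.* (fromℕ (suc t) ℚ.* fromℕ D))     ≡⟨ cong (p ℚ.*_) (ℚₚ.*-assoc W (fromℕ (suc t)) (fromℕ D)) ⟨
    p ℚ.* ((W ℚ.* fromℕ (suc t)) ℚ.* fromℕ D)     ≡⟨ cong (λ x → p ℚ.* (x ℚ.* fromℕ D)) (ℚₚ.*-comm W (fromℕ (suc t))) ⟩
    p ℚ.* ((fromℕ (suc t) ℚ.* W) ℚ.* fromℕ D)     ≡⟨ cong (p ℚ.*_) (ℚₚ.*-assoc (fromℕ (suc t)) W (fromℕ D)) ⟩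
    p ℚ.* (fromℕ (suc t) ℚ.* (W ℚ.* fromℕ D))     ≡⟨ ℚₚ.*-assoc p (fromℕ (suc t)) (W ℚ.* fromℕ D) ⟨
    (p ℚ.* fromℕ (suc t)) ℚ.* (W ℚ.* fromℕ D)     ≡⟨ cong (ℚ._* (W ℚ.* fromℕ D)) (/-*-cancel (lookup s j) t) ⟩
    fromℕ (lookup s j) ℚ.* (W ℚ.* fromℕ D)        ≡⟨ rest ⟩
    fromℕ (lookup s j) ℚ.* fromℕ C                ≡⟨ fromℕ-* (lookup s j) C ⟩
    fromℕ (lookup s j * C)                        ∎
    where
    p = ℤ.+ lookup s j ℚ./ suc t
    W = winProb σ (removeCard s j) (h ∷ʳ j) m
    C = count σ (removeCard s j) (h ∷ʳ j) m
    rest : fromℕ (lookup s j) ℚ.* (W ℚ.* fromℕ D) ≡ fromℕ (lookup s j) ℚ.* fromℕ C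
    rest with n≡0∨n>0 (lookup s j)
    -- Removing an absent value does not lower the total to `t`, so induction does not apply; both
    -- sides vanish instead.
    ... | inj₁ sj≡0 rewrite sj≡0 = trans (ℚₚ.*-zeroˡ (W ℚ.* fromℕ D)) (sym (ℚₚ.*-zeroˡ (fromℕ C)))
    ... | inj₂ 0<sj = cong (fromℕ (lookup s j) ℚ.*_)
      (subst (λ x → W ℚ.* fromℕ (deals x m) ≡ fromℕ C) Σ′ (winProb-count σ (removeCard s j) (h ∷ʳ j) m
        (≤-trans m≤t (≤-reflexive (sym Σ′)))))
      where
      Σ′ : sum (removeCard s j) ≡ t
      Σ′ = suc-injective (trans (sum-removeCard s j 0<sj) Σ≡)

module _ (s : Vec ℕ v) (m : ℕ) (m≤Σ : m ≤ sum s) (σ τ : Strategy v) where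

  private
    D = fromℕ (deals (sum s) m)

    D-positive : Positive D
    D-positive with deals (sum s) m | deals-positive (sum s) m m≤Σ
    ... | suc _ | _ = _

  count⇒winProbability : count τ s [] m ≤ count σ s [] m → winProbability τ s m ℚ.≤ winProbability σ s m
  count⇒winProbability τ≤σ = ℚₚ.*-cancelʳ-≤-pos D {{D-positive}} (begin
    winProbability τ s m ℚ.* D   ≡⟨ winProb-count τ s [] m m≤Σ ⟩
    fromℕ (count τ s [] m)       ≤⟨ fromℕ-mono-≤ τ≤σ ⟩
    fromℕ (count σ s [] m)       ≡⟨ winProb-count σ s [] m m≤Σ ⟨
    winProbability σ s m ℚ.* D   ∎)
    where open ℚₚ.≤-Reasoning

  winProbability⇒count : winProbability τ s m ℚ.≤ winProbability σ s m → count τ s [] m ≤ count σ s [] m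
  winProbability⇒count τ≤σ = fromℕ-cancel-≤ (begin
    fromℕ (count τ s [] m)       ≡⟨ winProb-count τ s [] m m≤Σ ⟨
    winProbability τ s m ℚ.* D   ≤⟨ ℚₚ.*-monoʳ-≤-nonNeg D {{ℚₚ.pos⇒nonNeg D {{D-positive}}}} τ≤σ ⟩
    winProbability σ s m ℚ.* D   ≡⟨ winProb-count σ s [] m m≤Σ ⟩
    fromℕ (count σ s [] m)       ∎)
    where open ℚₚ.≤-Reasoning

theorem1p2 : (v : ℕ) → 3 ≤ v → (s : Vec ℕ v) → (m : ℕ) → m ≤ sum s →
    (σ : Strategy v) → (Optimal s m σ → Greedy s m σ) × (Greedy s m σ → Optimal s m σ)
theorem1p2 (suc (suc (suc n))) (s≤s (s≤s (s≤s z≤n))) s m m≤Σ σ = optimal⇒greedy , greedy⇒optimal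
  where
  γ : Strategy (3 + n)
  γ = greedyStrategy s

  optimal⇒greedy : Optimal s m σ → Greedy s m σ
  -- An optimal `σ` does at least as well as `γ`, whose count reaches `best`.
  optimal⇒greedy opt = optimal-greedy m≤Σ (≤-trans
    (greedy-count (greedyStrategy-greedy s m) m start ≤-refl)
    (winProbability⇒count s m m≤Σ σ γ (opt γ)))

  greedy⇒optimal : Greedy s m σ → Optimal s m σ
  greedy⇒optimal G τ = count⇒winProbability s m m≤Σ σ τ
    (≤-trans (count≤best τ s [] m) (greedy-count G m start ≤-refl))
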